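{- Let $\mathbb{F}_q$ be a finite field with $q$ elements, let $P(X,Z)\in\mathbb{F}_q[X,Z]$ and $Q(X,Y,Z)\in\mathbb{F}_q[X,Y,Z]$. Suppose that $P(0,Z)\in\mathbb{F}_q[Z]$ has degree $m$ and that $Q(0,Y,Z)\in\mathbb{F}_q[Y,Z]$ is monic of degree $n$ in $Y$. Let $$N_0'=\#\{(\beta,\gamma)\in\mathbb{F}_q^2\mid P(0,\gamma)=0,\ Q(0,\beta,\gamma)=0\}.$$ Then $N_0'\le mn$.
   Context: "Monic of degree $n$ in $Y$" means that, as a polynomial in $Y$ over $\mathbb{F}_q[Z]$, it has degree $n$ and leading coefficient $1$. $P(0,Z)$ having degree $m$ means in particular that it is nonzero. -}

module Defs where

open import Level using (Level; _⊔_) renaming (suc to lsuc)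
open import Algebra.Bundles using (CommutativeRing)
open import Algebra.Bundles.Raw using (RawRing)
import Algebra.Definitions as AlgebraDefinitions
open import Data.Fin.Base using (Fin)
import Data.Fin.Properties as Fin
open import Data.List.Base using (List; []; _∷_; map; length; filter; tabulate; cartesianProduct)
open import Data.Nat.Base using (ℕ; zero; suc; _<_)
open import Data.Product.Base using (_×_; _,_)
open import Function.Bundles using (Inverse)
open import Function.Properties.Inverse using (Inverse⇒Injection) renaming (sym to inverse-sym)
open import Relation.Binary.Definitions using (Decidable)
open import Relation.Binary.PropositionalEquality.Properties using (setoid)
open import Relation.Nullary.Decidable using (via-injection; _×-dec_)
open import Relation.Nullary.Negation using (¬_)

record FiniteField (c ℓ : Level) (q : ℕ) : Set (lsuc (c ⊔ ℓ)) where
  field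
    commutativeRing : CommutativeRing c ℓ

  open CommutativeRing commutativeRing public
    renaming (setoid to carrierSetoid)
  open AlgebraDefinitions _≈_ using (Invertible)

  field
    1≉0         : ¬ (1# ≈ 0#)
    invertible  : ∀ x → ¬ (x ≈ 0#) → Invertible 1# _*_ x
    enumeration : Inverse (setoid (Fin q)) carrierSetoid

  infix 4 _≟_
  _≟_ : Decidable _≈_
  _≟_ = via-injection (Inverse⇒Injection (inverse-sym enumeration)) Fin._≟_

  -- Every element occurs exactly once up to _≈_.
  elements : List Carrier
  elements = tabulate (Inverse.to enumeration)

-- Polynomials in one variable as coefficient lists, constant term first.
-- Trailing zeros are allowed, so polynomials are compared by _≈ₚ_.
module Polynomial {c ℓ} (R : RawRing c ℓ) where
  open RawRing R

  Poly : Set c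
  Poly = List Carrier

  coeff : Poly → ℕ → Carrier
  coeff []      _       = 0#
  coeff (a ∷ p) zero    = a
  coeff (a ∷ p) (suc k) = coeff p k

  infix 4 _≈ₚ_
  _≈ₚ_ : Poly → Poly → Set ℓ
  p ≈ₚ r = ∀ k → coeff p k ≈ coeff r k

  infixl 6 _+ₚ_
  _+ₚ_ : Poly → Poly → Poly
  []      +ₚ r       = r
  (a ∷ p) +ₚ []      = a ∷ p
  (a ∷ p) +ₚ (b ∷ r) = (a + b) ∷ (p +ₚ r)

  infixl 7 _*ₚ_
  _*ₚ_ : Poly → Poly → Poly
  []      *ₚ r = []
  (a ∷ p) *ₚ r = map (a *_) r +ₚ (0# ∷ (p *ₚ r))

  const : Carrier → Poly
  const a = a ∷ []

  polyRing : RawRing c ℓ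
  polyRing = record
    { Carrier = Poly
    ; _≈_     = _≈ₚ_
    ; _+_     = _+ₚ_
    ; _*_     = _*ₚ_
    ; -_      = map (-_)
    ; 0#      = []
    ; 1#      = const 1#
    }

  eval : Poly → Carrier → Carrier
  eval []      x = 0#
  eval (a ∷ p) x = a + x * eval p x

  -- The zero polynomial has no degree in this sense.
  HasDegree : Poly → ℕ → Set ℓ
  HasDegree p d = ¬ (coeff p d ≈ 0#) × (∀ k → d < k → coeff p k ≈ 0#)

  MonicOfDegree : Poly → ℕ → Set ℓ
  MonicOfDegree p d = HasDegree p d × coeff p d ≈ 1#

-- F[X,Z] is F[Z][X] and F[X,Y,Z] is F[Z][Y][X].
module _ {c ℓ q} (F : FiniteField c ℓ q) where
  open FiniteField F

  F[Z] F[Z][Y] F[Z][X] F[Z][Y][X] : RawRing c ℓ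
  F[Z]       = Polynomial.polyRing rawRing
  F[Z][Y]    = Polynomial.polyRing F[Z]
  F[Z][X]    = Polynomial.polyRing F[Z]
  F[Z][Y][X] = Polynomial.polyRing F[Z][Y]

  private
    module OverF       = Polynomial rawRing
    module OverF[Z]    = Polynomial F[Z]
    module OverF[Z][Y] = Polynomial F[Z][Y]

  -- P(x,Z) and Q(x,Y,Z)
  specialiseXZ : RawRing.Carrier F[Z][X] → Carrier → RawRing.Carrier F[Z]
  specialiseXZ P x = OverF[Z].eval P (OverF.const x)

  specialiseXYZ : RawRing.Carrier F[Z][Y][X] → Carrier → RawRing.Carrier F[Z][Y]
  specialiseXYZ Q x = OverF[Z][Y].eval Q (OverF[Z].const (OverF.const x))

  -- P(x,z) and Q(x,y,z)
  evalXZ : RawRing.Carrier F[Z][X] → Carrier → Carrier → Carrier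
  evalXZ P x z = OverF.eval (specialiseXZ P x) z

  evalXYZ : RawRing.Carrier F[Z][Y][X] → Carrier → Carrier → Carrier → Carrier
  evalXYZ Q x y z = OverF.eval (OverF[Z].eval (specialiseXYZ Q x) (OverF.const y)) z

  N₀′ : RawRing.Carrier F[Z][X] → RawRing.Carrier F[Z][Y][X] → ℕ
  N₀′ P Q = length (filter
    (λ (β , γ) → (evalXZ P 0# γ ≟ 0#) ×-dec (evalXYZ Q 0# β γ ≟ 0#))
    (cartesianProduct elements elements))

{-# OPTIONS --safe #-}

-- For each γ, evaluating the coefficients of Q(0,Y,Z) at Z = γ gives a univariate
-- polynomial with leading coefficient 1, hence of degree n, so at most n values β go
-- with γ. Summing over the at most m roots γ of P(0,Z) gives the bound mn. The bound
-- on roots of a univariate polynomial comes from synthetic division by X − r.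
module Submission where

open import Defs
open import Algebra.Bundles using (CommutativeRing)
open import Algebra.Bundles.Raw using (RawRing)
import Algebra.Properties.AbelianGroup as AbelianGroupProperties
import Algebra.Properties.Ring as RingProperties
import Algebra.Solver.Ring.NaturalCoefficients.Default as SemiringSolver
open import Data.Empty using (⊥-elim)
open import Data.List.Base using (List; []; _∷_; _++_; map; length; filter; cartesianProduct)
open import Data.List.Properties using (filter-++; filter-none; length-++)
open import Data.List.Relation.Unary.All as All using (All; []; _∷_)
open import Data.List.Relation.Unary.All.Properties using (all-filter)
open import Data.List.Relation.Unary.AllPairs using ([]; _∷_)
import Data.List.Relation.Unary.Unique.Setoid as UniqueSetoid
import Data.List.Relation.Unary.Unique.Setoid.Properties as Unique
open import Data.Nat.Base using (ℕ; zero; suc; _≤_; _<_; _+_; _*_; z≤n; s≤s; s<s)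
open import Data.Nat.ListAction using (sum)
import Data.Nat.Properties as ℕ
open import Algebra.Properties.CommutativeSemigroup ℕ.+-commutativeSemigroup using (x∙yz≈y∙xz)
open import Data.Product.Base using (_×_; _,_)
open import Function.Base using (_∘_)
open import Function.Bundles using (Injection)
open import Function.Properties.Inverse using (Inverse⇒Injection)
open import Relation.Binary.PropositionalEquality as ≡ using (_≡_)
import Relation.Binary.Reasoning.Setoid as SetoidReasoning
open import Relation.Nullary.Decidable using (yes; no; _×-dec_)
open import Relation.Nullary.Negation using (¬_)
open import Relation.Unary using (Pred; Decidable)

-- Counting pairs by their second coordinate.

module _ {a b p} {A : Set a} {B : Set b} {S : Pred (A × B) p} (S? : Decidable S) where

  fibre : List A → B → List A
  fibre xs y = filter (λ x → S? (x , y)) xs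

  private
    -- Prepending `x` enlarges the fibre over `y` by one exactly when `S? (x , y)` succeeds, and
    -- each such `y` is one survivor of the new row.
    length-fibre-∷ : ∀ x xs ys →
      length (filter S? (map (x ,_) ys)) + sum (map (length ∘ fibre xs) ys)
        ≡ sum (map (length ∘ fibre (x ∷ xs)) ys)

    -- Shared by both outcomes of `S? (x , y)`: the old fibre over `y` is moved to the front, so
    -- that a success adds the same `suc` on both sides.
    fibre-first : ∀ x xs y ys →
      length (filter S? (map (x ,_) ys)) + sum (map (length ∘ fibre xs) (y ∷ ys))
        ≡ length (fibre xs y) + sum (map (length ∘ fibre (x ∷ xs)) ys)
    fibre-first x xs y ys = ≡.trans
      (x∙yz≈y∙xz (length (filter S? (map (x ,_) ys))) (length (fibre xs y))
        (sum (map (length ∘ fibre xs) ys)))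
      (≡.cong (length (fibre xs y) +_) (length-fibre-∷ x xs ys))

    length-fibre-∷ x xs [] = ≡.refl
    length-fibre-∷ x xs (y ∷ ys) with S? (x , y)
    ... | yes _ = ≡.cong suc (fibre-first x xs y ys)
    ... | no _  = fibre-first x xs y ys

  -- Double counting: the product list runs row by row in `xs`, while the sum groups the same pairs
  -- by `y`. Each row is absorbed by `length-fibre-∷`.
  length-filter-cartesianProduct : ∀ xs ys →
    length (filter S? (cartesianProduct xs ys)) ≡ sum (map (length ∘ fibre xs) ys)
  length-filter-cartesianProduct [] [] = ≡.refl
  length-filter-cartesianProduct [] (y ∷ ys) = length-filter-cartesianProduct [] ys
  length-filter-cartesianProduct (x ∷ xs) ys = begin
    length (filter S? (map (x ,_) ys ++ cartesianProduct xs ys))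
      ≡⟨ ≡.cong length (filter-++ S? (map (x ,_) ys) _) ⟩
    length (filter S? (map (x ,_) ys) ++ filter S? (cartesianProduct xs ys))
      ≡⟨ length-++ (filter S? (map (x ,_) ys)) ⟩
    length (filter S? (map (x ,_) ys)) + length (filter S? (cartesianProduct xs ys))
      ≡⟨ ≡.cong (length (filter S? (map (x ,_) ys)) +_) (length-filter-cartesianProduct xs ys) ⟩
    length (filter S? (map (x ,_) ys)) + sum (map (length ∘ fibre xs) ys)
      ≡⟨ length-fibre-∷ x xs ys ⟩
    sum (map (length ∘ fibre (x ∷ xs)) ys) ∎
    where open ≡.≡-Reasoning

sum-map-≤ : ∀ {b p} {B : Set b} {T : Pred B p} (T? : Decidable T) (f : B → ℕ) n →
  (∀ y → T y → f y ≤ n) → (∀ y → ¬ T y → f y ≡ 0) →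
  ∀ ys → sum (map f ys) ≤ length (filter T? ys) * n
sum-map-≤ T? f n f≤n f≡0 [] = z≤n
sum-map-≤ T? f n f≤n f≡0 (y ∷ ys) with T? y
... | yes t = ℕ.+-mono-≤ (f≤n y t) (sum-map-≤ T? f n f≤n f≡0 ys)
... | no ¬t rewrite f≡0 y ¬t = sum-map-≤ T? f n f≤n f≡0 ys

-- Evaluation of polynomials over a commutative ring.

module PolynomialProperties {c ℓ} (R : CommutativeRing c ℓ) where
  private module R = CommutativeRing R
  open R using (Carrier; _≈_; 0#; +-cong; +-congˡ; *-congˡ)
    renaming (_+_ to _⊕_; _*_ to _⊗_)
  open Polynomial R.rawRing
  open SemiringSolver R.commutativeSemiring using (solve; _:=_; _:+_; _:*_; con)
  open SetoidReasoning R.setoid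

  -- Lists equal under `_≈ₚ_` may differ in length by trailing zeros; the mixed cases show that such
  -- a tail evaluates to zero.
  eval-cong : ∀ p r x → p ≈ₚ r → eval p x ≈ eval r x
  eval-cong [] [] x eq = R.refl
  eval-cong [] (b ∷ r) x eq = begin
    0#                ≈⟨ solve 1 (λ x → con 0 := con 0 :+ x :* con 0) R.refl x ⟩
    0# ⊕ x ⊗ 0#       ≈⟨ +-cong (eq 0) (*-congˡ (eval-cong [] r x (eq ∘ suc))) ⟩
    b ⊕ x ⊗ eval r x  ∎
  eval-cong (a ∷ p) [] x eq = begin
    a ⊕ x ⊗ eval p x  ≈⟨ +-cong (eq 0) (*-congˡ (eval-cong p [] x (eq ∘ suc))) ⟩
    0# ⊕ x ⊗ 0#       ≈⟨ solve 1 (λ x → con 0 :+ x :* con 0 := con 0) R.refl x ⟩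
    0#                ∎
  eval-cong (a ∷ p) (b ∷ r) x eq = +-cong (eq 0) (*-congˡ (eval-cong p r x (eq ∘ suc)))

  eval-const : ∀ a x → eval (const a) x ≈ a
  eval-const = solve 2 (λ a x → a :+ x :* con 0 := a) R.refl

  eval-+ₚ : ∀ p r x → eval (p +ₚ r) x ≈ eval p x ⊕ eval r x
  eval-+ₚ [] r x = R.sym (R.+-identityˡ _)
  eval-+ₚ (a ∷ p) [] x = R.sym (R.+-identityʳ _)
  eval-+ₚ (a ∷ p) (b ∷ r) x = R.trans (+-congˡ (*-congˡ (eval-+ₚ p r x)))
    (solve 5 (λ a b x u v → a :+ b :+ x :* (u :+ v) := a :+ x :* u :+ (b :+ x :* v))
      R.refl a b x (eval p x) (eval r x))

  eval-map-* : ∀ a p x → eval (map (a ⊗_) p) x ≈ a ⊗ eval p x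
  eval-map-* a [] x = R.sym (R.zeroʳ a)
  eval-map-* a (b ∷ p) x = R.trans (+-congˡ (*-congˡ (eval-map-* a p x)))
    (solve 4 (λ a b x u → a :* b :+ x :* (a :* u) := a :* (b :+ x :* u))
      R.refl a b x (eval p x))

  eval-const-*ₚ : ∀ a p x → eval (const a *ₚ p) x ≈ a ⊗ eval p x
  eval-const-*ₚ a p x = begin
    eval (map (a ⊗_) p +ₚ const 0#) x         ≈⟨ eval-+ₚ (map (a ⊗_) p) (const 0#) x ⟩
    eval (map (a ⊗_) p) x ⊕ eval (const 0#) x ≈⟨ +-cong (eval-map-* a p x) (eval-const 0# x) ⟩
    a ⊗ eval p x ⊕ 0#                         ≈⟨ R.+-identityʳ _ ⟩
    a ⊗ eval p x                              ∎

  -- Substitution for the inner variable.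

  private module Bivariate = Polynomial polyRing

  evalCoefficients : Bivariate.Poly → Carrier → Poly
  evalCoefficients p z = map (λ r → eval r z) p

  -- The two variables may be substituted in either order: Horner's rule at `const y` uses only sums
  -- and products by a constant, and evaluation at `z` respects both.
  eval-evalCoefficients : ∀ p y z →
    eval (Bivariate.eval p (const y)) z ≈ eval (evalCoefficients p z) y
  eval-evalCoefficients [] y z = R.refl
  eval-evalCoefficients (r ∷ p) y z = begin
    eval (r +ₚ const y *ₚ Bivariate.eval p (const y)) z
      ≈⟨ eval-+ₚ r _ z ⟩
    eval r z ⊕ eval (const y *ₚ Bivariate.eval p (const y)) z
      ≈⟨ +-congˡ (eval-const-*ₚ y (Bivariate.eval p (const y)) z) ⟩
    eval r z ⊕ y ⊗ eval (Bivariate.eval p (const y)) z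
      ≈⟨ +-congˡ (*-congˡ (eval-evalCoefficients p y z)) ⟩
    eval r z ⊕ y ⊗ eval (evalCoefficients p z) y ∎

  coeff-evalCoefficients : ∀ p z k →
    coeff (evalCoefficients p z) k ≡ eval (Bivariate.coeff p k) z
  coeff-evalCoefficients [] z k = ≡.refl
  coeff-evalCoefficients (r ∷ p) z zero = ≡.refl
  coeff-evalCoefficients (r ∷ p) z (suc k) = coeff-evalCoefficients p z k

  -- A leading coefficient in Z could vanish at `z`; the constant 1 cannot, so the degree in Y
  -- survives the substitution.
  evalCoefficients-monic : ¬ (R.1# ≈ 0#) → ∀ {n} p z →
    Bivariate.MonicOfDegree p n → HasDegree (evalCoefficients p z) n
  evalCoefficients-monic 1≉0 {n} p z ((_ , above) , leading) =
    (λ eq → 1≉0 (R.trans (R.sym leading′) eq)) , above′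
    where
    leading′ : coeff (evalCoefficients p z) n ≈ R.1#
    leading′ = begin
      coeff (evalCoefficients p z) n  ≡⟨ coeff-evalCoefficients p z n ⟩
      eval (Bivariate.coeff p n) z    ≈⟨ eval-cong (Bivariate.coeff p n) (const R.1#) z leading ⟩
      eval (const R.1#) z             ≈⟨ eval-const R.1# z ⟩
      R.1#                            ∎
    above′ : ∀ k → n < k → coeff (evalCoefficients p z) k ≈ 0#
    above′ k n<k = begin
      coeff (evalCoefficients p z) k  ≡⟨ coeff-evalCoefficients p z k ⟩
      eval (Bivariate.coeff p k) z    ≈⟨ eval-cong (Bivariate.coeff p k) [] z (above k n<k) ⟩
      0#                              ∎

  -- Synthetic division by X - r.

  -- Coefficient k is the value at `r` of the list of coefficients of `p` from k + 1 on. A nonempty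
  -- `p` keeps its length, the last entry of the result being zero.
  quotient : Poly → Carrier → Poly
  quotient []      r = []
  quotient (_ ∷ p) r = eval p r ∷ quotient p r

  -- p(x) − p(r) = (x − r) q(x), rearranged into a semiring identity.
  eval-quotient : ∀ p r x →
    eval p x ⊕ r ⊗ eval (quotient p r) x ≈ eval p r ⊕ x ⊗ eval (quotient p r) x
  eval-quotient [] r x =
    solve 2 (λ r x → con 0 :+ r :* con 0 := con 0 :+ x :* con 0) R.refl r x
  eval-quotient (a ∷ p) r x = begin
    a ⊕ x ⊗ px ⊕ r ⊗ (pr ⊕ x ⊗ qx)
      ≈⟨ solve 6 (λ a r x px pr qx → a :+ x :* px :+ r :* (pr :+ x :* qx)
                    := a :+ r :* pr :+ x :* (px :+ r :* qx)) R.refl a r x px pr qx ⟩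
    a ⊕ r ⊗ pr ⊕ x ⊗ (px ⊕ r ⊗ qx)
      ≈⟨ +-congˡ (*-congˡ (eval-quotient p r x)) ⟩
    a ⊕ r ⊗ pr ⊕ x ⊗ (pr ⊕ x ⊗ qx) ∎
    where
    px = eval p x
    pr = eval p r
    qx = eval (quotient p r) x

  eval-degree-0 : ∀ p x → (∀ k → 0 < k → coeff p k ≈ 0#) → eval p x ≈ coeff p 0
  eval-degree-0 p x above = R.trans (eval-cong p (const (coeff p 0)) x p≈const) (eval-const _ x)
    where
    p≈const : p ≈ₚ const (coeff p 0)
    p≈const zero    = R.refl
    p≈const (suc k) = above (suc k) (s≤s z≤n)

  coeff-quotient-≈0 : ∀ p r d → (∀ k → d < k → coeff p k ≈ 0#) →
    ∀ k → d ≤ k → coeff (quotient p r) k ≈ 0#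
  coeff-quotient-≈0 [] r d above k d≤k = R.refl
  coeff-quotient-≈0 (a ∷ p) r d above zero z≤n =
    eval-cong p [] r (λ k → above (suc k) (s≤s z≤n))
  coeff-quotient-≈0 (a ∷ p) r d above (suc k) d≤1+k =
    -- The bound passed on is `k` itself, not a predecessor of `d`, which spares a case split on
    -- `d`: all coefficients of the tail beyond `k` vanish because `d ≤ suc k`.
    coeff-quotient-≈0 p r k (λ j k<j → above (suc j) (s≤s (ℕ.≤-trans d≤1+k k<j))) k ℕ.≤-refl

  -- Dropping constant terms lowers `d` to zero. The remaining tail is then a constant up to
  -- trailing zeros, so its value at `r` is its constant term.
  coeff-quotient-leading : ∀ p r d → (∀ k → suc d < k → coeff p k ≈ 0#) →
    coeff (quotient p r) d ≈ coeff p (suc d)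
  coeff-quotient-leading [] r d above = R.refl
  coeff-quotient-leading (a ∷ p) r zero above =
    eval-degree-0 p r (λ k 0<k → above (suc k) (s<s 0<k))
  coeff-quotient-leading (a ∷ p) r (suc d) above =
    coeff-quotient-leading p r d (λ k d<k → above (suc k) (s<s d<k))

  quotient-degree : ∀ {d} p r → HasDegree p (suc d) → HasDegree (quotient p r) d
  quotient-degree {d} p r (leading , above) =
    (λ eq → leading (R.trans (R.sym (coeff-quotient-leading p r d above)) eq)) ,
    -- The required `d < k` is by definition `suc d ≤ k`.
    coeff-quotient-≈0 p r (suc d) above

-- Counting roots over a finite field.

module RootBound {c ℓ q} (F : FiniteField c ℓ q) where
  open FiniteField F renaming (_+_ to _⊕_; _*_ to _⊗_)
  open Polynomial rawRing
  open PolynomialProperties commutativeRing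
  open RingProperties ring using ([y-z]x≈yx-zx)
  open AbelianGroupProperties +-abelianGroup using (x≈y⇒x∙y⁻¹≈ε; x∙y⁻¹≈ε⇒x≈y)
  open UniqueSetoid carrierSetoid using (Unique)
  open SetoidReasoning carrierSetoid

  *-cancelˡ-≈0 : ∀ {x y} → ¬ (x ≈ 0#) → x ⊗ y ≈ 0# → y ≈ 0#
  *-cancelˡ-≈0 {x} {y} x≉0 xy≈0 with invertible x x≉0
  ... | x⁻¹ , x⁻¹x≈1 , _ = begin
    y               ≈⟨ *-identityˡ y ⟨
    1# ⊗ y          ≈⟨ *-congʳ x⁻¹x≈1 ⟨
    (x⁻¹ ⊗ x) ⊗ y   ≈⟨ *-assoc x⁻¹ x y ⟩
    x⁻¹ ⊗ (x ⊗ y)   ≈⟨ *-congˡ xy≈0 ⟩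
    x⁻¹ ⊗ 0#        ≈⟨ zeroʳ x⁻¹ ⟩
    0#              ∎

  -- With both values of `p` zero, `eval-quotient` reads r q(x) = x q(x), so (r - x) q(x) = 0, and
  -- the nonzero factor r - x cancels.
  quotient-root : ∀ p {r x} → eval p r ≈ 0# → ¬ (r ≈ x) → eval p x ≈ 0# →
    eval (quotient p r) x ≈ 0#
  quotient-root p {r} {x} pr≈0 r≉x px≈0 =
    *-cancelˡ-≈0 (λ r-x≈0 → r≉x (x∙y⁻¹≈ε⇒x≈y r x r-x≈0))
      (trans ([y-z]x≈yx-zx qx r x) (x≈y⇒x∙y⁻¹≈ε rqx≈xqx))
    where
    qx = eval (quotient p r) x
    rqx≈xqx : r ⊗ qx ≈ x ⊗ qx
    rqx≈xqx = begin
      r ⊗ qx             ≈⟨ +-identityˡ _ ⟨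
      0# ⊕ r ⊗ qx        ≈⟨ +-congʳ px≈0 ⟨
      eval p x ⊕ r ⊗ qx  ≈⟨ eval-quotient p r x ⟩
      eval p r ⊕ x ⊗ qx  ≈⟨ +-congʳ pr≈0 ⟩
      0# ⊕ x ⊗ qx        ≈⟨ +-identityˡ _ ⟩
      x ⊗ qx             ∎

  -- Induction on the degree: division by X - r for the first root `r` lowers it by one, and the
  -- other roots, being distinct from `r`, pass to the quotient.
  length-roots : ∀ d p → HasDegree p d → ∀ {xs} → Unique xs →
    All (λ x → eval p x ≈ 0#) xs → length xs ≤ d
  length-roots d p deg [] [] = z≤n
  -- In degree zero `p` is a nonzero constant, which contradicts the existence of a root.
  length-roots zero p (leading , above) (_ ∷ _) (_∷_ {x = x} px≈0 _) =
    ⊥-elim (leading (trans (sym (eval-degree-0 p x above)) px≈0))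
  length-roots (suc d) p deg {r ∷ _} (r≉xs ∷ unique) (pr≈0 ∷ roots) =
    s≤s (length-roots d (quotient p r) (quotient-degree p r deg) unique
      (All.zipWith (λ (r≉x , px≈0) → quotient-root p pr≈0 r≉x px≈0) (r≉xs , roots)))

  elements-unique : Unique elements
  elements-unique = Unique.tabulate⁺ carrierSetoid
    (Injection.injective (Inverse⇒Injection enumeration))

  -- `S` only has to imply being a root, so this serves both for the roots of P(0,Z) and for the
  -- fibres, where `S` is a conjunction.
  length-filter-roots : ∀ {s} {S : Pred Carrier s} (S? : Decidable S) d p → HasDegree p d →
    (∀ {x} → S x → eval p x ≈ 0#) → length (filter S? elements) ≤ d
  length-filter-roots S? d p deg root = length-roots d p deg
    (Unique.filter⁺ carrierSetoid S? elements-unique) (All.map root (all-filter S? elements))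

proposition5p1 : ∀ {c ℓ} (q : ℕ) (F : FiniteField c ℓ q) (m n : ℕ)
    (P : RawRing.Carrier (F[Z][X] F)) (Q : RawRing.Carrier (F[Z][Y][X] F)) →
    Polynomial.HasDegree (FiniteField.rawRing F)
    (specialiseXZ F P (FiniteField.0# F)) m →
    Polynomial.MonicOfDegree (F[Z] F)
    (specialiseXYZ F Q (FiniteField.0# F)) n →
    N₀′ F P Q ≤ m * n
proposition5p1 q F m n P Q degP monicQ = begin
  N₀′ F P Q
    ≡⟨ length-filter-cartesianProduct S? elements elements ⟩
  sum (map (length ∘ fibre S? elements) elements)
    -- Fibres over roots of P(0,Z) have at most `n` points and all others are empty.
    ≤⟨ sum-map-≤ P? _ n (λ γ _ → fibre-≤ γ) fibre-≡0 elements ⟩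
  length (filter P? elements) * n
    -- `evalXZ F P 0# γ` unfolds to the value of `p` at `γ`, so the identity function suffices here.
    ≤⟨ ℕ.*-monoˡ-≤ n (length-filter-roots P? m p degP (λ pγ≈0 → pγ≈0)) ⟩
  m * n ∎
  where
  open FiniteField F using (Carrier; _≈_; _≟_; 0#; 1≉0; elements; commutativeRing; sym; trans)
  open PolynomialProperties commutativeRing
  open RootBound F
  open ℕ.≤-Reasoning

  p = specialiseXZ F P 0#
  r = specialiseXYZ F Q 0#

  P? : Decidable (λ γ → evalXZ F P 0# γ ≈ 0#)
  P? γ = evalXZ F P 0# γ ≟ 0#

  S? : Decidable (λ (β , γ) → evalXZ F P 0# γ ≈ 0# × evalXYZ F Q 0# β γ ≈ 0#)
  S? (β , γ) = P? γ ×-dec (evalXYZ F Q 0# β γ ≟ 0#)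

  fibre-≤ : ∀ γ → length (fibre S? elements γ) ≤ n
  fibre-≤ γ = length-filter-roots (λ β → S? (β , γ)) n (evalCoefficients r γ)
    (evalCoefficients-monic 1≉0 r γ monicQ)
    -- `evalXYZ` substitutes Y before Z, whereas the root bound concerns the polynomial in Y
    -- obtained at Z = γ.
    (λ {β} (_ , rβγ≈0) → trans (sym (eval-evalCoefficients r β γ)) rβγ≈0)

  fibre-≡0 : ∀ γ → ¬ (evalXZ F P 0# γ ≈ 0#) → length (fibre S? elements γ) ≡ 0
  fibre-≡0 γ pγ≉0 = ≡.cong length
    (filter-none (λ β → S? (β , γ)) (All.universal (λ β (pγ≈0 , _) → pγ≉0 pγ≈0) elements))
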